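{- Let $f(n)$ be the number of equivalence classes of the relation $\sim$ on $\mathfrak{S}_n$ for $n\ge 1$, and set $f(0)=1$. Then $$f(n)=\sum_{j=0}^{\lfloor n/2\rfloor}(-1)^j\,(n-j)!\binom{n-j}{j}.$$ Equivalently, as formal power series, $$\sum_{n\ge 0}f(n)x^n=\sum_{m\ge 0}m!\,\bigl(x(1-x)\bigr)^m.$$
   Context: Permutations $w\in\mathfrak{S}_n$ are regarded as words $a_1a_2\cdots a_n$. Two permutations $u,v\in\mathfrak{S}_n$ are equivalent, $u\sim v$, if $v$ can be obtained from $u$ by a sequence of interchanges of two adjacent entries $a_i,a_{i+1}$ satisfying $|a_i-a_{i+1}|=1$. -}

module Defs where

open import Data.Nat using (ℕ; zero; suc; _∸_; _*_; _!)
open import Data.Nat.DivMod using (_/_)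
open import Data.Nat.Combinatorics using (_C_)
open import Data.Integer as ℤ using (ℤ; +_; -1ℤ; 0ℤ)
open import Data.List using (List; []; _∷_; map; upTo; foldr; length)
open import Data.List.Relation.Binary.Permutation.Propositional using (_↭_)
open import Data.List.Relation.Unary.All using (All)
open import Data.List.Relation.Unary.Any using (Any)
open import Data.List.Relation.Unary.AllPairs using (AllPairs)
open import Data.Sum using (_⊎_)
open import Relation.Binary.PropositionalEquality using (_≡_)
open import Relation.Binary.Construct.Closure.ReflexiveTransitive using (Star)
open import Relation.Nullary using (¬_)

IsPerm : ℕ → List ℕ → Set
IsPerm n w = w ↭ map suc (upTo n)

data Step : List ℕ → List ℕ → Set where
  here  : ∀ {a b xs} → (a ≡ suc b ⊎ b ≡ suc a) → Step (a ∷ b ∷ xs) (b ∷ a ∷ xs)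
  there : ∀ {x xs ys} → Step xs ys → Step (x ∷ xs) (x ∷ ys)

_∼_ : List ℕ → List ℕ → Set
u ∼ v = Star Step u v

-- reps is a complete system of representatives of the classes of ∼ on 𝔖_n:
-- every element is in 𝔖_n, distinct elements lie in distinct classes, and
-- every permutation in 𝔖_n is equivalent to some element.  Hence
-- length reps = number of equivalence classes of ∼ on 𝔖_n.
record ClassReps (n : ℕ) (reps : List (List ℕ)) : Set where
  field
    reps-perm     : All (IsPerm n) reps
    reps-distinct : AllPairs (λ u v → ¬ (u ∼ v)) reps
    reps-cover    : ∀ w → IsPerm n w → Any (λ r → w ∼ r) reps

term : ℕ → ℕ → ℤ
term n j = (-1ℤ ℤ.^ j) ℤ.* (+ (((n ∸ j) !) * ((n ∸ j) C j)))

formula : ℕ → ℤ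
formula n = foldr ℤ._+_ 0ℤ (map (term n) (upTo (suc (n / 2))))

{-# OPTIONS --safe #-}
module Submission where

-- The lexicographically largest word of each class is the only one without a
-- factor i (i+1) or i (i+2) (i+1), so f(n) counts the permutations avoiding
-- these factors.  Let B(m, K) be the number of arrangements of m letters,
-- among them 1, …, K, that avoid those of these factors whose letters are all
-- at most K.  An arrangement counted by B(m, K+1) but not by B(m, K+2) contains
-- (K+1) (K+2) or K (K+2) (K+1), and deleting K+2 is a bijection from these
-- arrangements onto those counted by B(m-1, K).  Hence
-- B(m, K+2) = B(m, K+1) - B(m-1, K) with B(m, 0) = B(m, 1) = m!, and Pascal's
-- rule gives B(m, K) = Σ_j (-1)^j (m-j)! C(K-j, j); finally f(n) = B(n, n).

open import Defs
open import Data.Empty using (⊥-elim)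
open import Data.Integer as ℤ using (ℤ; +_; 0ℤ; -1ℤ)
import Data.Integer.Properties as ℤₚ
import Data.Integer.Tactic.RingSolver as ℤ-Solver
open import Data.List using (List; []; _∷_; _++_; map; concatMap; foldr; applyUpTo; upTo; downFrom; filter; last; length)
open import Data.List.Properties using (map-++; map-∘; map-upTo; ++-identityʳ; reverse-upTo; filter-all; filter-reject; filter-accept; ∷-injectiveˡ; ∷-injectiveʳ)
open import Data.List.Membership.Propositional using (_∈_; _∉_; find; lose)
open import Data.List.Membership.Propositional.Properties using (∈-∃++; ∈-++⁺ˡ; ∈-++⁺ʳ; ∈-++⁻; ∈-map⁺; ∈-map⁻; ∈-concatMap⁺; ∈-concatMap⁻; ∈-filter⁺; ∈-filter⁻; ∈-upTo⁻; ∈-downFrom⁻)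
open import Data.List.Relation.Binary.Disjoint.Propositional using (Disjoint)
open import Data.List.Relation.Binary.Permutation.Propositional as ↭ using (_↭_; refl; prep; swap; ↭-refl; ↭-sym; ↭-trans; ↭-reflexive; ↭⇒↭ₛ)
open import Data.List.Relation.Binary.Permutation.Propositional.Properties using (shift; drop-mid; ∈-resp-↭; ↭-length; ↭-reverse; map⁺; ↭-empty-inv)
import Data.List.Relation.Binary.Permutation.Setoid.Properties as ↭ₛ
open import Data.List.Relation.Unary.All as All using (All; []; _∷_)
import Data.List.Relation.Unary.All.Properties as Allₚ
open import Data.List.Relation.Unary.AllPairs using (AllPairs; []; _∷_)
import Data.List.Relation.Unary.AllPairs.Properties as AllPairsₚ
open import Data.List.Relation.Unary.Any using (here; there)
open import Data.List.Relation.Unary.Unique.Propositional using (Unique)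
import Data.List.Relation.Unary.Unique.Propositional.Properties as Uniqueₚ
open import Data.Maybe using (just)
open import Data.Maybe.Properties using (≡-dec)
open import Data.Nat using (ℕ; zero; suc; _+_; _*_; _∸_; _<_; _≤_; z≤n; s≤s; _≟_; _!)
open import Data.Nat.Combinatorics using (_C_; nCk+nC[k+1]≡[n+1]C[k+1]; nCn≡1; nCk≡nC[n∸k]; k>n⇒nCk≡0)
open import Data.Nat.DivMod using (_/_; m≡m%n+[m/n]*n; m%n<n)
open import Data.Nat.ListAction using (sum)
open import Data.Nat.ListAction.Properties using (sum-++)
open import Data.Nat.Properties using (+-suc; +-identityʳ; +-comm; *-identityʳ; *-zeroʳ; *-distribˡ-+; +-∸-assoc; m≤n⇒m∸n≡0; +-monoˡ-≤; ≤-pred; ≤-reflexive; ≤-trans; ≤-<-connex; <-trans; <-irrefl; <⇒≢; n<1+n; n≤1+n; 1+n≰n; n≮0; m<n⇒m<1+n; m≤n⇒m<n∨m≡n; suc-injective)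
open import Data.Nat.Tactic.RingSolver using (solve-∀)
open import Data.Product using (Σ; _×_; _,_; proj₁; proj₂)
open import Data.Sum using (_⊎_; inj₁; inj₂; [_,_]′)
open import Function using (_∘_)
open import Relation.Binary.Construct.Closure.ReflexiveTransitive using (ε; _◅_; _◅◅_; gmap)
open import Relation.Binary.PropositionalEquality using (_≡_; _≢_; refl; sym; trans; cong; cong₂; setoid; module ≡-Reasoning)
open import Relation.Nullary using (¬_; Dec; yes; no; ¬?; _×-dec_)
open import Relation.Nullary.Decidable using (map′)

-- Normal forms

-- The index of Factor is the largest letter of the forbidden factor.
data Factor : ℕ → List ℕ → Set where
  adj   : ∀ {i w} → Factor (suc i) (i ∷ suc i ∷ w)
  skip  : ∀ {i w} → Factor (suc (suc i)) (i ∷ suc (suc i) ∷ suc i ∷ w)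
  there : ∀ {t x w} → Factor t w → Factor t (x ∷ w)

Normal : List ℕ → Set
Normal w = ∀ {t} → ¬ Factor t w

Normal-tail : ∀ {x w} → Normal (x ∷ w) → Normal w
Normal-tail N = N ∘ there

Factor⇒pred∈ : ∀ {i w} → Factor (suc i) w → i ∈ w
Factor⇒pred∈ adj       = here refl
Factor⇒pred∈ skip      = there (there (here refl))
Factor⇒pred∈ (there f) = there (Factor⇒pred∈ f)

Factor⇒top∈ : ∀ {t w} → Factor t w → t ∈ w
Factor⇒top∈ adj       = there (here refl)
Factor⇒top∈ skip      = there (here refl)
Factor⇒top∈ (there f) = there (Factor⇒top∈ f)

-- `x` in front of `w` opens a factor of either kind or none; `free` records the last case in the
-- form in which normality uses it.
data Head (x : ℕ) : List ℕ → Set where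
  adj  : ∀ u → Head x (suc x ∷ u)
  skip : ∀ u → Head x (suc (suc x) ∷ suc x ∷ u)
  free : ∀ {w} → (∀ {t} → Factor t (x ∷ w) → Factor t w) → Head x w

head-view : ∀ x w → Head x w
head-view x [] = free λ { (there ()) }
head-view x (y ∷ w) with y ≟ suc x
... | yes refl = adj w
head-view x (y ∷ []) | no y≢ = free λ { adj → ⊥-elim (y≢ refl) ; (there f) → f }
head-view x (y ∷ z ∷ w) | no y≢ with y ≟ suc (suc x) | z ≟ suc x
... | yes refl | yes refl = skip w
... | no y≢₂   | _        = free λ { adj → ⊥-elim (y≢ refl) ; skip → ⊥-elim (y≢₂ refl) ; (there f) → f }
... | yes _    | no z≢    = free λ { adj → ⊥-elim (y≢ refl) ; skip → ⊥-elim (z≢ refl) ; (there f) → f }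

-- Meant for normal `w`: brings `x ∷ w` into normal form. In the second case x (x+2) (x+1) u passes
-- through x (x+1) (x+2) u to (x+1) x (x+2) u. Now x+2 stands directly before u, so the repair
-- continues there.
insert : ℕ → List ℕ → List ℕ
insert x w with head-view x w
... | adj u  = suc x ∷ x ∷ u
... | skip u = suc x ∷ x ∷ insert (suc (suc x)) u
... | free _ = x ∷ w

normalise : List ℕ → List ℕ
normalise = foldr insert []

insert-adj : ∀ x u → insert x (suc x ∷ u) ≡ suc x ∷ x ∷ u
insert-adj x u with suc x ≟ suc x
... | yes refl = refl
... | no ≢     = ⊥-elim (≢ refl)

insert-skip : ∀ x u → insert x (suc (suc x) ∷ suc x ∷ u) ≡ suc x ∷ x ∷ insert (suc (suc x)) u
insert-skip x u with suc (suc x) ≟ suc x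
... | no _ with suc (suc x) ≟ suc (suc x) | suc x ≟ suc x
... | yes refl | yes refl = refl
... | no ≢     | _        = ⊥-elim (≢ refl)
... | yes _    | no ≢     = ⊥-elim (≢ refl)

insert-normal : ∀ {x w} → Normal (x ∷ w) → insert x w ≡ x ∷ w
insert-normal {x} {w} N with head-view x w
... | adj _  = ⊥-elim (N adj)
... | skip _ = ⊥-elim (N skip)
... | free _ = refl

insert-∉ : ∀ {x w} → suc x ∉ w → insert x w ≡ x ∷ w
insert-∉ {x} {w} ∉w with head-view x w
... | adj _  = ⊥-elim (∉w (here refl))
... | skip _ = ⊥-elim (∉w (there (here refl)))
... | free _ = refl

insert-suc-∷ : ∀ x w → insert (suc x) (x ∷ w) ≡ suc x ∷ x ∷ w
insert-suc-∷ x w with head-view (suc x) (x ∷ w)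
... | free _ = refl

insert-↭ : ∀ x w → insert x w ↭ x ∷ w
insert-↭ x w with head-view x w
... | adj u  = swap (suc x) x ↭-refl
... | skip u = ↭-trans (prep (suc x) (prep x (insert-↭ (suc (suc x)) u)))
                 (↭-trans (swap (suc x) x ↭-refl) (prep x (swap (suc x) (suc (suc x)) ↭-refl)))
... | free _ = ↭-refl

normalise-↭ : ∀ w → normalise w ↭ w
normalise-↭ []      = ↭-refl
normalise-↭ (x ∷ w) = ↭-trans (insert-↭ x (normalise w)) (prep x (normalise-↭ w))

∼-∷ : ∀ {x u v} → u ∼ v → (x ∷ u) ∼ (x ∷ v)
∼-∷ = gmap (_ ∷_) there

insert-∼ : ∀ x w → (x ∷ w) ∼ insert x w
insert-∼ x w with head-view x w
... | adj u  = here (inj₂ refl) ◅ ε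
... | skip u = there (here (inj₁ refl)) ◅ here (inj₂ refl) ◅ ∼-∷ (∼-∷ (insert-∼ (suc (suc x)) u))
... | free _ = ε

normalise-∼ : ∀ w → w ∼ normalise w
normalise-∼ []      = ε
normalise-∼ (x ∷ w) = ∼-∷ (normalise-∼ w) ◅◅ insert-∼ x (normalise w)

Unique-resp-↭ : ∀ {u v : List ℕ} → u ↭ v → Unique u → Unique v
Unique-resp-↭ p = ↭ₛ.Unique-resp-↭ (setoid ℕ) (↭⇒↭ₛ p)

Unique⇒∉ : ∀ {x : ℕ} {w} → Unique (x ∷ w) → x ∉ w
Unique⇒∉ (x≢ ∷ _) x∈ = All.lookup x≢ x∈ refl

Unique-tail : ∀ {x : ℕ} {w} → Unique (x ∷ w) → Unique w
Unique-tail (_ ∷ U) = U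

-- Both kinds of factor opened by `x` contain `suc x`.
Normal-∷-∉ : ∀ {x w} → suc x ∉ w → Normal w → Normal (x ∷ w)
Normal-∷-∉ ∉w N adj       = ∉w (here refl)
Normal-∷-∉ ∉w N skip      = ∉w (there (here refl))
Normal-∷-∉ ∉w N (there f) = N f

-- A factor opened by `suc x` continues with a larger letter, never with `x`.
Normal-suc-∷ : ∀ {x w} → Normal (x ∷ w) → Normal (suc x ∷ x ∷ w)
Normal-suc-∷ N (there f) = N f

insert-Normal : ∀ {x w} → Unique (x ∷ w) → Normal w → Normal (insert x w)
insert-Normal {x} {w} U N with head-view x w
... | adj u  = Normal-suc-∷ (Normal-∷-∉ (Unique⇒∉ (Unique-tail U)) (Normal-tail N))
... | skip u = Normal-suc-∷ (Normal-∷-∉ sx∉ (insert-Normal U₂ (Normal-tail (Normal-tail N))))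
  where
  U′ : Unique (suc x ∷ suc (suc x) ∷ u)
  U′ = Unique-resp-↭ (swap _ _ ↭-refl) (Unique-tail U)
  U₂ : Unique (suc (suc x) ∷ u)
  U₂ = Unique-tail U′
  sx∉ : suc x ∉ insert (suc (suc x)) u
  sx∉ = Unique⇒∉ U′ ∘ ∈-resp-↭ (insert-↭ (suc (suc x)) u)
... | free f = N ∘ f

normalise-Normal : ∀ {w} → Unique w → Normal (normalise w)
normalise-Normal {[]}    U ()
normalise-Normal {x ∷ w} U =
  insert-Normal (Unique-resp-↭ (prep x (↭-sym (normalise-↭ w))) U) (normalise-Normal (Unique-tail U))

normalise-fixed : ∀ {w} → Normal w → normalise w ≡ w
normalise-fixed {[]}    N = refl
normalise-fixed {x ∷ w} N = trans (cong (insert x) (normalise-fixed (Normal-tail N))) (insert-normal N)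

-- Inserting `i` undoes whatever `suc i` did to `w`. For w = (i+2) u the first insertion gives (i+2)
-- (i+1) u; then `i` moves i+2 back in front of u, where it stays because `w` is normal. For w =
-- (i+3) (i+2) u the same situation recurs on u with i+2 and i+3.
insert-insert-suc : ∀ i w → Unique w → suc i ∉ w → Normal w → insert i (insert (suc i) w) ≡ suc i ∷ i ∷ w
insert-insert-suc i w U ∉w N with head-view (suc i) w
... | adj u  = trans (insert-skip i u) (cong (λ z → suc i ∷ i ∷ z) (insert-normal N))
... | skip u = trans (insert-skip i (insert (suc (suc (suc i))) u)) (cong (λ z → suc i ∷ i ∷ z)
    (insert-insert-suc (suc (suc i)) u (Unique-tail (Unique-tail U)) (Unique⇒∉ U ∘ there) (Normal-tail (Normal-tail N))))
... | free _ = insert-adj i w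

insert-suc-insert : ∀ i w → suc i ∉ w → insert (suc i) (insert i w) ≡ suc i ∷ i ∷ w
insert-suc-insert i w ∉w = trans (cong (insert (suc i)) (insert-∉ ∉w)) (insert-suc-∷ i w)

insert-comm-suc : ∀ i w → Unique w → suc i ∉ w → Normal w →
                  insert i (insert (suc i) w) ≡ insert (suc i) (insert i w)
insert-comm-suc i w U ∉w N = trans (insert-insert-suc i w U ∉w N) (sym (insert-suc-insert i w ∉w))

Step⇒↭ : ∀ {u v} → Step u v → u ↭ v
Step⇒↭ (here _)  = swap _ _ ↭-refl
Step⇒↭ (there s) = prep _ (Step⇒↭ s)

-- A swap at the front only changes the order in which two consecutive values are inserted into the
-- normal form of the common tail, and these insertions commute.
normalise-Step : ∀ {u v} → Unique u → Step u v → normalise u ≡ normalise v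
normalise-Step U (here {b = i} {xs} (inj₁ refl)) = sym (insert-comm-suc i (normalise xs)
  (Unique-resp-↭ (↭-sym (normalise-↭ xs)) (Unique-tail (Unique-tail U)))
  (Unique⇒∉ U ∘ there ∘ ∈-resp-↭ (normalise-↭ xs)) (normalise-Normal (Unique-tail (Unique-tail U))))
normalise-Step U (here {a = i} {xs = xs} (inj₂ refl)) = insert-comm-suc i (normalise xs)
  (Unique-resp-↭ (↭-sym (normalise-↭ xs)) (Unique-tail (Unique-tail U)))
  (Unique⇒∉ (Unique-tail U) ∘ ∈-resp-↭ (normalise-↭ xs)) (normalise-Normal (Unique-tail (Unique-tail U)))
normalise-Step U (there {x} s) = cong (insert x) (normalise-Step (Unique-tail U) s)

normalise-resp-∼ : ∀ {u v} → Unique u → u ∼ v → normalise u ≡ normalise v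
normalise-resp-∼ U ε        = refl
normalise-resp-∼ U (s ◅ ss) =
  trans (normalise-Step U s) (normalise-resp-∼ (Unique-resp-↭ (Step⇒↭ s) U) ss)

-- A normal word is its own normal form, and normal forms are constant on classes of words without
-- repeated letters.
Normal-∼⇒≡ : ∀ {u v} → Unique u → Normal u → Normal v → u ∼ v → u ≡ v
Normal-∼⇒≡ U Nu Nv u∼v =
  trans (sym (normalise-fixed Nu)) (trans (normalise-resp-∼ U u∼v) (normalise-fixed Nv))

-- Sums over insertions and arrangements

sumInserts : (List ℕ → ℕ) → ℕ → List ℕ → ℕ
sumInserts F a []      = F (a ∷ [])
sumInserts F a (x ∷ v) = F (a ∷ x ∷ v) + sumInserts (F ∘ (x ∷_)) a v

-- The head of the list is inserted last, so deleting that letter can be studied through its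
-- insertions into one fixed word.
sumPerms : (List ℕ → ℕ) → List ℕ → ℕ
sumPerms F []      = F []
sumPerms F (a ∷ A) = sumPerms (sumInserts F a) A

sumInserts-cong : ∀ {F G} a v → (∀ w → w ↭ a ∷ v → F w ≡ G w) → sumInserts F a v ≡ sumInserts G a v
sumInserts-cong a []      h = h _ ↭-refl
sumInserts-cong a (x ∷ v) h = cong₂ _+_ (h _ ↭-refl)
  (sumInserts-cong a v λ w p → h (x ∷ w) (↭-trans (prep x p) (swap x a ↭-refl)))

sumInserts-zero : ∀ a v → sumInserts (λ _ → 0) a v ≡ 0
sumInserts-zero a []      = refl
sumInserts-zero a (x ∷ v) = sumInserts-zero a v

+-interchange : ∀ a b c d → (a + b) + (c + d) ≡ (a + c) + (b + d)
+-interchange = solve-∀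

sumInserts-+ : ∀ F G a v → sumInserts (λ w → F w + G w) a v ≡ sumInserts F a v + sumInserts G a v
sumInserts-+ F G a []      = refl
sumInserts-+ F G a (x ∷ v) =
  trans (cong (_+_ (F (a ∷ x ∷ v) + G (a ∷ x ∷ v))) (sumInserts-+ (F ∘ (x ∷_)) (G ∘ (x ∷_)) a v))
        (+-interchange (F (a ∷ x ∷ v)) (G (a ∷ x ∷ v)) _ _)

-- This makes `sumPerms` independent of the order of the letters. Words beginning with `a` or `b`
-- are split off; those beginning with `x` fall under the induction hypothesis.
sumInserts-comm : ∀ F a b v → sumInserts (sumInserts F a) b v ≡ sumInserts (sumInserts F b) a v
sumInserts-comm F a b []      = +-comm (F (a ∷ b ∷ [])) (F (b ∷ a ∷ []))
sumInserts-comm F a b (x ∷ v) = begin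
  L + sumInserts (λ w → F (a ∷ x ∷ w) + sumInserts (F ∘ (x ∷_)) a w) b v
    ≡⟨ cong (_+_ L) (sumInserts-+ (F ∘ (a ∷_) ∘ (x ∷_)) (sumInserts (F ∘ (x ∷_)) a) b v) ⟩
  L + (S b a + sumInserts (sumInserts (F ∘ (x ∷_)) a) b v)
    ≡⟨ cong (λ z → L + (S b a + z)) (sumInserts-comm (F ∘ (x ∷_)) a b v) ⟩
  L + (S b a + sumInserts (sumInserts (F ∘ (x ∷_)) b) a v)
    ≡⟨ rearrange (F (a ∷ b ∷ x ∷ v)) (F (b ∷ a ∷ x ∷ v)) (S a b) (S b a) _ ⟩
  R + (S a b + sumInserts (sumInserts (F ∘ (x ∷_)) b) a v)
    ≡⟨ cong (_+_ R) (sumInserts-+ (F ∘ (b ∷_) ∘ (x ∷_)) (sumInserts (F ∘ (x ∷_)) b) a v) ⟨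
  R + sumInserts (λ w → F (b ∷ x ∷ w) + sumInserts (F ∘ (x ∷_)) b w) a v ∎
  where
  open ≡-Reasoning
  S : ℕ → ℕ → ℕ
  S c d = sumInserts (λ w → F (d ∷ x ∷ w)) c v
  L = F (a ∷ b ∷ x ∷ v) + (F (b ∷ a ∷ x ∷ v) + S a b)
  R = F (b ∷ a ∷ x ∷ v) + (F (a ∷ b ∷ x ∷ v) + S b a)
  rearrange : ∀ p q r s t → (p + (q + r)) + (s + t) ≡ (q + (p + s)) + (r + t)
  rearrange = solve-∀

sumPerms-cong : ∀ {F G} A → (∀ w → w ↭ A → F w ≡ G w) → sumPerms F A ≡ sumPerms G A
sumPerms-cong []      h = h [] ↭-refl
sumPerms-cong (a ∷ A) h = sumPerms-cong A λ v p → sumInserts-cong a v λ w q → h w (↭-trans q (prep a p))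

sumPerms-+ : ∀ F G A → sumPerms (λ w → F w + G w) A ≡ sumPerms F A + sumPerms G A
sumPerms-+ F G []      = refl
sumPerms-+ F G (a ∷ A) = trans (sumPerms-cong A λ v _ → sumInserts-+ F G a v)
                               (sumPerms-+ (sumInserts F a) (sumInserts G a) A)

sumPerms-↭ : ∀ F {A B} → A ↭ B → sumPerms F A ≡ sumPerms F B
sumPerms-↭ F refl          = refl
sumPerms-↭ F (prep x p)    = sumPerms-↭ (sumInserts F x) p
sumPerms-↭ F {B = _ ∷ _ ∷ B} (swap x y p)  =
  trans (sumPerms-↭ (sumInserts (sumInserts F x) y) p)
        (sumPerms-cong B λ v _ → sumInserts-comm F x y v)
sumPerms-↭ F (↭.trans p q) = trans (sumPerms-↭ F p) (sumPerms-↭ F q)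

sumInserts-const : ∀ c a v → sumInserts (λ _ → c) a v ≡ suc (length v) * c
sumInserts-const c a []      = sym (+-identityʳ c)
sumInserts-const c a (x ∷ v) = cong (_+_ c) (sumInserts-const c a v)

sumPerms-const : ∀ c A → sumPerms (λ _ → c) A ≡ length A ! * c
sumPerms-const c []      = sym (+-identityʳ c)
sumPerms-const c (a ∷ A) = begin
  sumPerms (sumInserts (λ _ → c) a) A        ≡⟨ sumPerms-cong A (λ v p → trans (sumInserts-const c a v) (cong (λ l → suc l * c) (↭-length p))) ⟩
  sumPerms (λ _ → suc (length A) * c) A      ≡⟨ sumPerms-const (suc (length A) * c) A ⟩
  length A ! * (suc (length A) * c)          ≡⟨ rearrange (length A !) (length A) c ⟩
  suc (length A) ! * c                       ∎
  where
  open ≡-Reasoning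
  rearrange : ∀ f l c → f * (suc l * c) ≡ (suc l * f) * c
  rearrange = solve-∀

-- Explicit lists of arrangements

inserts : ℕ → List ℕ → List (List ℕ)
inserts a []      = (a ∷ []) ∷ []
inserts a (x ∷ v) = (a ∷ x ∷ v) ∷ map (x ∷_) (inserts a v)

perms : List ℕ → List (List ℕ)
perms []      = [] ∷ []
perms (a ∷ A) = concatMap (inserts a) (perms A)

sum-inserts : ∀ F a v → sum (map F (inserts a v)) ≡ sumInserts F a v
sum-inserts F a []      = +-identityʳ _
sum-inserts F a (x ∷ v) = cong (_+_ (F (a ∷ x ∷ v)))
  (trans (cong sum (sym (map-∘ (inserts a v)))) (sum-inserts (F ∘ (x ∷_)) a v))

sum-concatMap-inserts : ∀ F a vs → sum (map F (concatMap (inserts a) vs)) ≡ sum (map (sumInserts F a) vs)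
sum-concatMap-inserts F a []       = refl
sum-concatMap-inserts F a (v ∷ vs) = begin
  sum (map F (inserts a v ++ concatMap (inserts a) vs))                ≡⟨ cong sum (map-++ F (inserts a v) _) ⟩
  sum (map F (inserts a v) ++ map F (concatMap (inserts a) vs))        ≡⟨ sum-++ (map F (inserts a v)) _ ⟩
  sum (map F (inserts a v)) + sum (map F (concatMap (inserts a) vs))   ≡⟨ cong₂ _+_ (sum-inserts F a v) (sum-concatMap-inserts F a vs) ⟩
  sumInserts F a v + sum (map (sumInserts F a) vs)                     ∎
  where open ≡-Reasoning

-- Links the list from which representatives are drawn with the recursive sum in which the counting
-- is done.
sum-perms : ∀ F A → sum (map F (perms A)) ≡ sumPerms F A
sum-perms F []      = +-identityʳ _
sum-perms F (a ∷ A) = trans (sum-concatMap-inserts F a (perms A)) (sum-perms (sumInserts F a) A)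

∈-inserts⁺ : ∀ a p q → p ++ a ∷ q ∈ inserts a (p ++ q)
∈-inserts⁺ a []      []      = here refl
∈-inserts⁺ a []      (_ ∷ _) = here refl
∈-inserts⁺ a (x ∷ p) q       = there (∈-map⁺ (x ∷_) (∈-inserts⁺ a p q))

∈-inserts⇒↭ : ∀ {a} v {w} → w ∈ inserts a v → w ↭ a ∷ v
∈-inserts⇒↭ []      (here refl) = ↭-refl
∈-inserts⇒↭ (x ∷ v) (here refl) = ↭-refl
∈-inserts⇒↭ (x ∷ v) (there m) with _ , m′ , refl ← ∈-map⁻ (x ∷_) m =
  ↭-trans (prep x (∈-inserts⇒↭ v m′)) (swap x _ ↭-refl)

∈-perms⇒↭ : ∀ A {w} → w ∈ perms A → w ↭ A
∈-perms⇒↭ []      (here refl) = ↭-refl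
∈-perms⇒↭ (a ∷ A) m with v , v∈ , w∈ ← find (∈-concatMap⁻ (inserts a) {xs = perms A} m) =
  ↭-trans (∈-inserts⇒↭ v w∈) (prep a (∈-perms⇒↭ A v∈))

↭⇒∈-perms : ∀ A {w} → w ↭ A → w ∈ perms A
↭⇒∈-perms [] p with refl ← ↭-empty-inv p = here refl
↭⇒∈-perms (a ∷ A) w↭ with ∈-∃++ (∈-resp-↭ (↭-sym w↭) (here refl))
... | p , q , refl =
  ∈-concatMap⁺ (inserts a) (lose (↭⇒∈-perms A (drop-mid p [] w↭)) (∈-inserts⁺ a p q))

delete : ℕ → List ℕ → List ℕ
delete a = filter (λ x → ¬? (x ≟ a))

delete-head : ∀ {a} v → a ∉ v → delete a (a ∷ v) ≡ v
delete-head {a} v a∉v = trans (filter-reject (λ x → ¬? (x ≟ a)) (λ a≢a → a≢a refl))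
  (filter-all (λ x → ¬? (x ≟ a)) (All.tabulate λ { m refl → a∉v m }))

delete-∈-inserts : ∀ {a} v {w} → a ∉ v → w ∈ inserts a v → delete a w ≡ v
delete-∈-inserts []      a∉v (here refl) = delete-head [] a∉v
delete-∈-inserts (x ∷ v) a∉v (here refl) = delete-head (x ∷ v) a∉v
delete-∈-inserts {a} (x ∷ v) a∉v (there m) with _ , m′ , refl ← ∈-map⁻ (x ∷_) m =
  trans (filter-accept (λ y → ¬? (y ≟ a)) (a∉v ∘ here ∘ sym))
        (cong (x ∷_) (delete-∈-inserts v (a∉v ∘ there) m′))

inserts-Unique : ∀ {a} v → a ∉ v → Unique (inserts a v)
inserts-Unique []      a∉ = [] ∷ []
inserts-Unique (x ∷ v) a∉ =
  All.tabulate (λ m e → a∉ (here (head≡ m e))) ∷ Uniqueₚ.map⁺ ∷-injectiveʳ (inserts-Unique v (a∉ ∘ there))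
  where
  head≡ : ∀ {w} → w ∈ map (x ∷_) (inserts _ v) → _ ∷ x ∷ v ≡ w → _ ≡ x
  head≡ m e with _ , _ , refl ← ∈-map⁻ (x ∷_) m = ∷-injectiveˡ e

-- Deleting `a` from a common element would return both `u` and `v`.
inserts-Disjoint : ∀ {a u v} → a ∉ u → a ∉ v → u ≢ v → Disjoint (inserts a u) (inserts a v)
inserts-Disjoint {u = u} {v} a∉u a∉v u≢v (w∈u , w∈v) =
  u≢v (trans (sym (delete-∈-inserts u a∉u w∈u)) (delete-∈-inserts v a∉v w∈v))

AllPairs-map-All : ∀ {X : Set} {P : X → Set} {R S : X → X → Set} →
  (∀ {x y} → P x → P y → R x y → S x y) → ∀ {xs} → All P xs → AllPairs R xs → AllPairs S xs
AllPairs-map-All f []       []       = []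
AllPairs-map-All f (p ∷ ps) (r ∷ rs) =
  All.zipWith (λ (py , rxy) → f p py rxy) (ps , r) ∷ AllPairs-map-All f ps rs

perms-Unique : ∀ {A} → Unique A → Unique (perms A)
perms-Unique {[]}    U = [] ∷ []
perms-Unique {a ∷ A} U = Uniqueₚ.concat⁺
  (Allₚ.map⁺ (All.map (λ {v} → inserts-Unique v) a∉perms))
  (AllPairsₚ.map⁺ (AllPairs-map-All {S = λ u v → Disjoint (inserts a u) (inserts a v)} inserts-Disjoint
    a∉perms (perms-Unique (Unique-tail U))))
  where
  a∉perms : All (a ∉_) (perms A)
  a∉perms = All.tabulate λ m a∈v → Unique⇒∉ U (∈-resp-↭ (∈-perms⇒↭ A m) a∈v)

-- Counting normal words

indicator : ∀ {P : Set} → Dec P → ℕ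
indicator (yes _) = 1
indicator (no _)  = 0

indicator-⇔ : ∀ {P Q : Set} (p : Dec P) (q : Dec Q) → (P → Q) → (Q → P) → indicator p ≡ indicator q
indicator-⇔ (yes p) (yes q) f g = refl
indicator-⇔ (yes p) (no ¬q) f g = ⊥-elim (¬q (f p))
indicator-⇔ (no ¬p) (yes q) f g = ⊥-elim (¬p (g q))
indicator-⇔ (no ¬p) (no ¬q) f g = refl

indicator-no : ∀ {P : Set} (p : Dec P) → ¬ P → indicator p ≡ 0
indicator-no p ¬p = indicator-⇔ p (no ¬p) (λ x → x) (λ x → x)

indicator-yes : ∀ {P : Set} (p : Dec P) → P → indicator p ≡ 1
indicator-yes p x = indicator-⇔ p (yes x) (λ x → x) (λ x → x)

-- In its application `P` is normality up to a bound, `Q` the presence of a factor with the next top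
-- letter, and `R` normality up to the next bound.
indicator-split : ∀ {P Q R : Set} (p : Dec P) (q : Dec Q) (r : Dec R) → (R → P × ¬ Q) → (P × ¬ Q → R) →
                  indicator p ≡ indicator r + indicator q * indicator p
indicator-split (yes p) (yes q) r f g = cong (_+ 1) (sym (indicator-no r λ x → proj₂ (f x) q))
indicator-split (yes p) (no ¬q) r f g = trans (sym (indicator-yes r (g (p , ¬q)))) (sym (+-identityʳ _))
indicator-split (no ¬p) (yes q) r f g = sym (trans (+-identityʳ _) (indicator-no r (¬p ∘ proj₁ ∘ f)))
indicator-split (no ¬p) (no ¬q) r f g = sym (trans (+-identityʳ _) (indicator-no r (¬p ∘ proj₁ ∘ f)))

length-filter-sum : ∀ {P : List ℕ → Set} (P? : ∀ w → Dec (P w)) ws →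
                    length (filter P? ws) ≡ sum (map (indicator ∘ P?) ws)
length-filter-sum P? [] = refl
length-filter-sum P? (w ∷ ws) with P? w
... | yes _ = cong suc (length-filter-sum P? ws)
... | no _  = length-filter-sum P? ws

factor? : ∀ k w → Dec (Factor (suc (suc k)) w)
factor? k [] = no λ ()
factor? k (x ∷ w) with factor? k w
... | yes f = yes (there f)
factor? k (x ∷ []) | no ¬f = no λ { (there f) → ¬f f }
factor? k (x ∷ y ∷ w) | no ¬f with y ≟ suc (suc k)
... | no y≢ = no λ { adj → y≢ refl ; skip → y≢ refl ; (there f) → ¬f f }
... | yes refl with x ≟ suc k
...   | yes refl = yes adj
factor? k (x ∷ _ ∷ []) | no ¬f | yes refl | no x≢ = no λ { adj → x≢ refl ; (there f) → ¬f f }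
factor? k (x ∷ _ ∷ z ∷ w) | no ¬f | yes refl | no x≢ with x ≟ k | z ≟ suc k
... | yes refl | yes refl = yes skip
... | no x≢₂   | _        = no λ { adj → x≢ refl ; skip → x≢₂ refl ; (there f) → ¬f f }
... | yes _    | no z≢    = no λ { adj → x≢ refl ; skip → z≢ refl ; (there f) → ¬f f }

-- Factors with largest letter 1 involve the letter 0, which permutations do not contain.
NormalUpTo : ℕ → List ℕ → Set
NormalUpTo K w = ∀ {k} → suc k < K → ¬ Factor (suc (suc k)) w

NormalUpTo-suc⁻ : ∀ {K w} → NormalUpTo (suc (suc K)) w → NormalUpTo (suc K) w × ¬ Factor (suc (suc K)) w
NormalUpTo-suc⁻ {K} N = (λ lt → N (m<n⇒m<1+n lt)) , N (n<1+n (suc K))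

NormalUpTo-suc⁺ : ∀ {K w} → NormalUpTo (suc K) w × ¬ Factor (suc (suc K)) w → NormalUpTo (suc (suc K)) w
NormalUpTo-suc⁺ (N , ¬f) lt with m≤n⇒m<n∨m≡n (≤-pred lt)
... | inj₁ lt′  = N lt′
... | inj₂ refl = ¬f

normalUpTo? : ∀ K w → Dec (NormalUpTo K w)
normalUpTo? zero          w = yes λ ()
normalUpTo? (suc zero)    w = yes λ { (s≤s ()) }
normalUpTo? (suc (suc K)) w =
  map′ NormalUpTo-suc⁺ NormalUpTo-suc⁻ (normalUpTo? (suc K) w ×-dec ¬? (factor? K w))

-- For an alphabet of m letters that include 1, ..., K this is B(m, K).
countNormal : ℕ → List ℕ → ℕ
countNormal K = sumPerms (indicator ∘ normalUpTo? K)

-- Insertions of the top letter that create a factor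

Factor-++⁺ˡ : ∀ {t p} q → Factor t p → Factor t (p ++ q)
Factor-++⁺ˡ q adj       = adj
Factor-++⁺ˡ q skip      = skip
Factor-++⁺ˡ q (there f) = there (Factor-++⁺ˡ q f)

Factor-++⁺ʳ : ∀ {t q} p → Factor t q → Factor t (p ++ q)
Factor-++⁺ʳ []      f = f
Factor-++⁺ʳ (x ∷ p) f = there (Factor-++⁺ʳ p f)

-- All letters of the factor are at most `t`, so it cannot run across `z`.
Factor-split : ∀ {t z} p {q} → t < z → Factor t (p ++ z ∷ q) → Factor t p ⊎ Factor t q
Factor-split [] t<z adj = ⊥-elim (<-irrefl refl (<-trans t<z (n<1+n _)))
Factor-split [] t<z skip = ⊥-elim (<-irrefl refl (<-trans t<z (<-trans (n<1+n _) (n<1+n _))))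
Factor-split [] t<z (there f) = inj₂ f
Factor-split (x ∷ []) t<z adj = ⊥-elim (<-irrefl refl t<z)
Factor-split (x ∷ []) t<z skip = ⊥-elim (<-irrefl refl t<z)
Factor-split (x ∷ []) t<z (there f) = [ inj₁ ∘ there , inj₂ ]′ (Factor-split [] t<z f)
Factor-split (x ∷ y ∷ []) t<z adj = inj₁ adj
Factor-split (x ∷ y ∷ []) t<z skip = ⊥-elim (<-irrefl refl (<-trans t<z (n<1+n _)))
Factor-split (x ∷ y ∷ []) t<z (there f) = [ inj₁ ∘ there , inj₂ ]′ (Factor-split (y ∷ []) t<z f)
Factor-split (x ∷ y ∷ u ∷ p) t<z adj = inj₁ adj
Factor-split (x ∷ y ∷ u ∷ p) t<z skip = inj₁ skip
Factor-split (x ∷ y ∷ u ∷ p) t<z (there f) = [ inj₁ ∘ there , inj₂ ]′ (Factor-split (y ∷ u ∷ p) t<z f)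

module _ {k : ℕ} where
  private
    b c : ℕ
    b = suc k
    c = suc (suc k)

  endsIn? : ∀ p → Dec (last p ≡ just k)
  endsIn? p = ≡-dec _≟_ (last p) (just k)

  -- `F` cut down to the words with a factor of largest letter `c`, that is b c or k c b.
  top-weight : (List ℕ → ℕ) → List ℕ → ℕ
  top-weight F w = indicator (factor? k w) * F w

  top-weight-zero : ∀ F {w} → ¬ Factor c w → top-weight F w ≡ 0
  top-weight-zero F {w} ¬f = cong (_* F w) (indicator-no (factor? k w) ¬f)

  top-weight-one : ∀ F {w} → Factor c w → top-weight F w ≡ F w
  top-weight-one F {w} f = trans (cong (_* F w) (indicator-yes (factor? k w) f)) (+-identityʳ _)

  top-weight-∷ : ∀ F {x w} → (Factor c (x ∷ w) → Factor c w) → top-weight F (x ∷ w) ≡ top-weight (F ∘ (x ∷_)) w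
  top-weight-∷ F {x} {w} h = cong (_* F (x ∷ w)) (indicator-⇔ (factor? k (x ∷ w)) (factor? k w) h there)

  -- Every factor with top `c` contains `b`, which occurs only at the front here; so only the
  -- insertion right behind it contributes.
  sumInserts-after-mid : ∀ F {q} → b ∉ q → c ∉ q →
    sumInserts (λ w → top-weight F (b ∷ w)) c q ≡ F (b ∷ c ∷ q)
  sumInserts-after-mid F {[]}    b∉ c∉ = top-weight-one F adj
  sumInserts-after-mid F {y ∷ q} b∉ c∉ = begin
    top-weight F (b ∷ c ∷ y ∷ q) + sumInserts (λ w → top-weight F (b ∷ y ∷ w)) c q
      ≡⟨ cong₂ _+_ (top-weight-one F adj) (sumInserts-cong c q λ w p → top-weight-zero F (no-factor w p)) ⟩
    F (b ∷ c ∷ y ∷ q) + sumInserts (λ _ → 0) c q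
      ≡⟨ cong (_+_ (F (b ∷ c ∷ y ∷ q))) (sumInserts-zero c q) ⟩
    F (b ∷ c ∷ y ∷ q) + 0
      ≡⟨ +-identityʳ _ ⟩
    F (b ∷ c ∷ y ∷ q) ∎
    where
    open ≡-Reasoning
    b∉yw : ∀ w → w ↭ c ∷ q → b ∉ y ∷ w
    b∉yw w p (here e)  = b∉ (here e)
    b∉yw w p (there m) with ∈-resp-↭ p m
    ... | there m′ = b∉ (there m′)
    no-factor : ∀ w → w ↭ c ∷ q → ¬ Factor c (b ∷ y ∷ w)
    no-factor w p adj       = c∉ (here refl)
    no-factor w p (there f) = b∉yw w p (Factor⇒pred∈ f)

  -- The letter `x` is kept in view because k c b begins one letter ahead of `c`. The induction
  -- moves `x` along until it stands next to `b`.
  sumInserts-before-mid : ∀ F x p {q} → All (λ y → y ≢ b × y ≢ c) (x ∷ p) → b ∉ q → c ∉ q →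
    sumInserts (λ w → top-weight F (x ∷ w)) c (p ++ b ∷ q) ≡
    F (x ∷ p ++ b ∷ c ∷ q) + indicator (endsIn? (x ∷ p)) * F (x ∷ p ++ c ∷ b ∷ q)
  sumInserts-before-mid F x [] {q} ((x≢b , x≢c) ∷ []) b∉ c∉ = begin
    top-weight F (x ∷ c ∷ b ∷ q) + sumInserts (λ w → top-weight F (x ∷ b ∷ w)) c q
      ≡⟨ cong₂ _+_ here-weight (sumInserts-cong c q λ w _ → top-weight-∷ F (tail w)) ⟩
    indicator (endsIn? (x ∷ [])) * F (x ∷ c ∷ b ∷ q) + sumInserts (λ w → top-weight (F ∘ (x ∷_)) (b ∷ w)) c q
      ≡⟨ cong (_+_ (indicator (endsIn? (x ∷ [])) * F (x ∷ c ∷ b ∷ q))) (sumInserts-after-mid (F ∘ (x ∷_)) b∉ c∉) ⟩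
    indicator (endsIn? (x ∷ [])) * F (x ∷ c ∷ b ∷ q) + F (x ∷ b ∷ c ∷ q)
      ≡⟨ +-comm (indicator (endsIn? (x ∷ [])) * F (x ∷ c ∷ b ∷ q)) (F (x ∷ b ∷ c ∷ q)) ⟩
    F (x ∷ b ∷ c ∷ q) + indicator (endsIn? (x ∷ [])) * F (x ∷ c ∷ b ∷ q) ∎
    where
    open ≡-Reasoning
    tail : ∀ w → Factor c (x ∷ b ∷ w) → Factor c (b ∷ w)
    tail w (there f) = f
    to : Factor c (x ∷ c ∷ b ∷ q) → just x ≡ just k
    to adj  = ⊥-elim (x≢b refl)
    to skip = refl
    to (there (there (there f))) = ⊥-elim (b∉ (Factor⇒pred∈ f))
    to (there (there adj)) = ⊥-elim (c∉ (here refl))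
    from : just x ≡ just k → Factor c (x ∷ c ∷ b ∷ q)
    from refl = skip
    here-weight = cong (_* F (x ∷ c ∷ b ∷ q))
      (indicator-⇔ (factor? k (x ∷ c ∷ b ∷ q)) (endsIn? (x ∷ [])) to from)
  sumInserts-before-mid F x (y ∷ p) {q} ((x≢b , x≢c) ∷ (y≢b , y≢c) ∷ ps) b∉ c∉ = begin
    top-weight F (x ∷ c ∷ y ∷ p ++ b ∷ q) + sumInserts (λ w → top-weight F (x ∷ y ∷ w)) c (p ++ b ∷ q)
      -- Between `x` and `y` the letter `c` touches no `b`, hence lies in no factor; in the other
      -- words `y` differs from `c`, so `x` opens no factor with top `c`.
      ≡⟨ cong₂ _+_ (top-weight-zero F no-factor) (sumInserts-cong c (p ++ b ∷ q) λ w _ → top-weight-∷ F (tail w)) ⟩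
    sumInserts (λ w → top-weight (F ∘ (x ∷_)) (y ∷ w)) c (p ++ b ∷ q)
      ≡⟨ sumInserts-before-mid (F ∘ (x ∷_)) y p ((y≢b , y≢c) ∷ ps) b∉ c∉ ⟩
    F (x ∷ y ∷ p ++ b ∷ c ∷ q) + indicator (endsIn? (y ∷ p)) * F (x ∷ y ∷ p ++ c ∷ b ∷ q) ∎
    where
    open ≡-Reasoning
    tail : ∀ w → Factor c (x ∷ y ∷ w) → Factor c (y ∷ w)
    tail w adj       = ⊥-elim (y≢c refl)
    tail w skip      = ⊥-elim (y≢c refl)
    tail w (there f) = f
    c∉tail : c ∉ y ∷ p ++ b ∷ q
    c∉tail m with ∈-++⁻ (y ∷ p) m
    ... | inj₁ m′         = proj₂ (All.lookup ((y≢b , y≢c) ∷ ps) m′) refl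
    ... | inj₂ (there m′) = c∉ m′
    no-factor : ¬ Factor c (x ∷ c ∷ y ∷ p ++ b ∷ q)
    no-factor adj  = x≢b refl
    no-factor skip = y≢b refl
    no-factor (there (there f)) = c∉tail (Factor⇒top∈ f)

  -- Neither factor starts with `c`, so inserting `c` at the very front contributes nothing. What
  -- remains is the place behind `b`, and the place ahead of `b` when `p` ends in `k`.
  sumInserts-top : ∀ F p {q} → All (λ y → y ≢ b × y ≢ c) p → b ∉ q → c ∉ q →
    sumInserts (top-weight F) c (p ++ b ∷ q) ≡
    F (p ++ b ∷ c ∷ q) + indicator (endsIn? p) * F (p ++ c ∷ b ∷ q)
  sumInserts-top F [] {q} [] b∉ c∉ = begin
    top-weight F (c ∷ b ∷ q) + sumInserts (λ w → top-weight F (b ∷ w)) c q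
      ≡⟨ cong₂ _+_ (top-weight-zero F no-factor) (sumInserts-after-mid F b∉ c∉) ⟩
    F (b ∷ c ∷ q)
      ≡⟨ +-identityʳ _ ⟨
    F (b ∷ c ∷ q) + 0 ∎
    where
    open ≡-Reasoning
    no-factor : ¬ Factor c (c ∷ b ∷ q)
    no-factor (there adj)       = c∉ (here refl)
    no-factor (there (there f)) = c∉ (Factor⇒top∈ f)
  sumInserts-top F (x ∷ p) {q} ps b∉ c∉ =
    trans (cong (_+ sumInserts (λ w → top-weight F (x ∷ w)) c (p ++ b ∷ q)) (top-weight-zero F no-factor)) (sumInserts-before-mid F x p ps b∉ c∉)
    where
    no-factor : ¬ Factor c (c ∷ x ∷ p ++ b ∷ q)
    no-factor (there f) with ∈-++⁻ (x ∷ p) (Factor⇒top∈ f)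
    ... | inj₁ m′         = proj₂ (All.lookup ps m′) refl
    ... | inj₂ (there m′) = c∉ m′

-- Normality under deletion of the top letter

last⇒Factor : ∀ {i} p {q} → last p ≡ just i → Factor (suc i) (p ++ suc i ∷ q)
last⇒Factor (x ∷ [])    refl = adj
last⇒Factor (x ∷ y ∷ p) e    = there (last⇒Factor (y ∷ p) e)

last⇒∈ : ∀ {i : ℕ} p → last p ≡ just i → i ∈ p
last⇒∈ (x ∷ [])    refl = here refl
last⇒∈ (x ∷ y ∷ p) e    = there (last⇒∈ (y ∷ p) e)

-- A factor opened by `z` has its largest letter above `z`.
Factor-∷⁻ : ∀ {t z q} → t ≤ z → Factor t (z ∷ q) → Factor t q
Factor-∷⁻ t≤z adj       = ⊥-elim (1+n≰n t≤z)
Factor-∷⁻ t≤z skip      = ⊥-elim (1+n≰n (≤-trans (n≤1+n _) t≤z))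
Factor-∷⁻ t≤z (there f) = f

module _ {k : ℕ} where
  private
    b c : ℕ
    b = suc k
    c = suc (suc k)

  -- The only `b` is followed by `c`, which rules out the factor (k-1) b k and leaves k b.
  Factor⇒last : ∀ p {q} → b ∉ p → b ∉ q → Factor b (p ++ b ∷ c ∷ q) → last p ≡ just k
  Factor⇒last [] b∉p b∉q (there f) with Factor⇒top∈ f
  ... | there m = ⊥-elim (b∉q m)
  Factor⇒last (x ∷ []) b∉p b∉q adj       = refl
  Factor⇒last (x ∷ []) b∉p b∉q (there f) with () ← Factor⇒last [] (λ ()) b∉q f
  Factor⇒last (x ∷ y ∷ []) b∉p b∉q adj           = ⊥-elim (b∉p (there (here refl)))
  Factor⇒last (x ∷ y ∷ []) b∉p b∉q (there f)     = Factor⇒last (y ∷ []) (b∉p ∘ there) b∉q f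
  Factor⇒last (x ∷ y ∷ z ∷ p) b∉p b∉q adj        = ⊥-elim (b∉p (there (here refl)))
  Factor⇒last (x ∷ y ∷ z ∷ p) b∉p b∉q skip       = ⊥-elim (b∉p (there (here refl)))
  Factor⇒last (x ∷ y ∷ z ∷ p) b∉p b∉q (there f)  = Factor⇒last (y ∷ z ∷ p) (b∉p ∘ there) b∉q f

  -- A factor with top `b` would force `p` to end in `k`; a factor with smaller top contains neither
  -- `b` nor `c`, so it was there before `c` was inserted.
  Normal-mid-top : ∀ p {q} → b ∉ p → b ∉ q → last p ≢ just k →
    NormalUpTo k (p ++ b ∷ q) → NormalUpTo (suc k) (p ++ b ∷ c ∷ q)
  Normal-mid-top p {q} b∉p b∉q ¬l N lt f with m≤n⇒m<n∨m≡n (≤-pred lt)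
  ... | inj₂ refl = ¬l (Factor⇒last p b∉p b∉q f)
  ... | inj₁ lt′ with Factor-split p (s≤s lt′) f
  ...   | inj₁ g = N lt′ (Factor-++⁺ˡ _ g)
  ...   | inj₂ g = N lt′ (Factor-++⁺ʳ p (there (Factor-∷⁻ (≤-trans lt (n≤1+n _)) g)))

  -- In both factors with top `b` a smaller letter precedes `b`, whereas here its predecessor is
  -- `c`.
  Normal-top-mid : ∀ p {q} → b ∉ p → b ∉ q →
    NormalUpTo k (p ++ b ∷ q) → NormalUpTo (suc k) (p ++ c ∷ b ∷ q)
  Normal-top-mid p {q} b∉p b∉q N lt f
    with m≤n⇒m<n∨m≡n (≤-pred lt) | Factor-split p (s≤s lt) f
  ... | inj₁ lt′  | inj₁ g = N lt′ (Factor-++⁺ˡ _ g)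
  ... | inj₁ lt′  | inj₂ g = N lt′ (Factor-++⁺ʳ p g)
  ... | inj₂ refl | inj₁ g = b∉p (Factor⇒top∈ g)
  ... | inj₂ refl | inj₂ g = b∉q (Factor⇒top∈ (Factor-∷⁻ lt g))

  Normal-drop-top : ∀ p {q} w → (∀ {t} → Factor t p ⊎ Factor t q → Factor t w) →
    NormalUpTo (suc k) w → NormalUpTo k (p ++ b ∷ q)
  Normal-drop-top p w embed N lt f = N (m<n⇒m<1+n lt) (embed (Factor-split p (s≤s lt) f))

  -- The insertion of c that survives goes before b if p ends in k, and after b otherwise.
  sumInserts-Normal : ∀ p {q} → All (λ y → y ≢ b × y ≢ c) p → b ∉ q → c ∉ q → 0 ∉ p →
    sumInserts (top-weight {k} (indicator ∘ normalUpTo? (suc k))) c (p ++ b ∷ q) ≡ indicator (normalUpTo? k (p ++ b ∷ q))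
  sumInserts-Normal p {q} ps b∉q c∉q 0∉p = trans (sumInserts-top (indicator ∘ normalUpTo? (suc k)) p ps b∉q c∉q) eval
    where
    b∉p : b ∉ p
    b∉p m = proj₁ (All.lookup ps m) refl
    eval : indicator (normalUpTo? (suc k) (p ++ b ∷ c ∷ q)) + indicator (endsIn? {k} p) * indicator (normalUpTo? (suc k) (p ++ c ∷ b ∷ q))
           ≡ indicator (normalUpTo? k (p ++ b ∷ q))
    eval with endsIn? {k} p
    ... | no ¬l = trans (+-identityʳ _) (indicator-⇔ (normalUpTo? (suc k) (p ++ b ∷ c ∷ q)) (normalUpTo? k (p ++ b ∷ q))
            (Normal-drop-top p _ [ Factor-++⁺ˡ _ , (λ g → Factor-++⁺ʳ p (there (there g))) ]′)
            (Normal-mid-top p b∉p b∉q ¬l))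
    ... | yes l = cong₂ _+_ (indicator-no (normalUpTo? (suc k) (p ++ b ∷ c ∷ q)) (contra k l))
            (trans (+-identityʳ _) (indicator-⇔ (normalUpTo? (suc k) (p ++ c ∷ b ∷ q)) (normalUpTo? k (p ++ b ∷ q))
              (Normal-drop-top p _ [ Factor-++⁺ˡ _ , (λ g → Factor-++⁺ʳ p (there (there g))) ]′)
              (Normal-top-mid p b∉p b∉q)))
      where
      contra : ∀ k → last p ≡ just k → ¬ NormalUpTo (suc k) (p ++ suc k ∷ suc (suc k) ∷ q)
      -- The factor 0 1 is not among those that `NormalUpTo` inspects, so this case is excluded by
      -- the absence of the letter 0.
      contra zero    l N = 0∉p (last⇒∈ p l)
      contra (suc j) l N = N (n<1+n _) (last⇒Factor p l)

  -- The recurrence in additive form. Since `c` heads the list it is inserted last, and the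
  -- bijection is checked separately above each arrangement of `b ∷ A`.
  countNormal-step : ∀ {A} → All (λ y → y ≢ 0 × y ≢ b × y ≢ c) A →
    countNormal (suc k) (c ∷ b ∷ A) ≡ countNormal (suc (suc k)) (c ∷ b ∷ A) + countNormal k (b ∷ A)
  countNormal-step {A} hA = begin
    countNormal (suc k) (c ∷ b ∷ A)
      ≡⟨ sumPerms-cong (c ∷ b ∷ A) (λ w _ → indicator-split (normalUpTo? (suc k) w) (factor? k w) (normalUpTo? (suc (suc k)) w)
           NormalUpTo-suc⁻ NormalUpTo-suc⁺) ⟩
    sumPerms (λ w → indicator (normalUpTo? (suc (suc k)) w) + top-weight {k} (indicator ∘ normalUpTo? (suc k)) w) (c ∷ b ∷ A)
      ≡⟨ sumPerms-+ (indicator ∘ normalUpTo? (suc (suc k))) _ (c ∷ b ∷ A) ⟩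
    countNormal (suc (suc k)) (c ∷ b ∷ A) + sumPerms (top-weight {k} (indicator ∘ normalUpTo? (suc k))) (c ∷ b ∷ A)
      ≡⟨ cong (_+_ (countNormal (suc (suc k)) (c ∷ b ∷ A))) (sumPerms-cong (b ∷ A) insertions) ⟩
    countNormal (suc (suc k)) (c ∷ b ∷ A) + countNormal k (b ∷ A) ∎
    where
    open ≡-Reasoning
    insertions : ∀ v → v ↭ b ∷ A →
      sumInserts (top-weight {k} (indicator ∘ normalUpTo? (suc k))) c v ≡ indicator (normalUpTo? k v)
    insertions v v↭ with ∈-∃++ (∈-resp-↭ (↭-sym v↭) (here refl))
    ... | p , q , refl = sumInserts-Normal p
            (All.tabulate λ m → proj₂ (h (∈-++⁺ˡ m)))
            (λ m → proj₁ (proj₂ (h (∈-++⁺ʳ p m))) refl)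
            (λ m → proj₂ (proj₂ (h (∈-++⁺ʳ p m))) refl)
            (λ m → proj₁ (h (∈-++⁺ˡ m)) refl)
      where
      h : ∀ {y} → y ∈ p ++ q → y ≢ 0 × y ≢ b × y ≢ c
      h m = All.lookup hA (∈-resp-↭ (drop-mid p [] v↭) m)

-- The alternating sum

sumUpTo : (ℕ → ℤ) → ℕ → ℤ
sumUpTo f zero    = 0ℤ
sumUpTo f (suc N) = f 0 ℤ.+ sumUpTo (f ∘ suc) N

foldr-applyUpTo : ∀ f N → foldr ℤ._+_ 0ℤ (applyUpTo f N) ≡ sumUpTo f N
foldr-applyUpTo f zero    = refl
foldr-applyUpTo f (suc N) = cong (ℤ._+_ (f 0)) (foldr-applyUpTo (f ∘ suc) N)

sumUpTo-zero : ∀ f N → (∀ j → f j ≡ 0ℤ) → sumUpTo f N ≡ 0ℤ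
sumUpTo-zero f zero    h = refl
sumUpTo-zero f (suc N) h = cong₂ ℤ._+_ (h 0) (sumUpTo-zero (f ∘ suc) N (h ∘ suc))

sumUpTo-minus : ∀ f g h N → (∀ j → f j ≡ g j ℤ.- h j) → sumUpTo f N ≡ sumUpTo g N ℤ.- sumUpTo h N
sumUpTo-minus f g h zero    e = refl
sumUpTo-minus f g h (suc N) e =
  trans (cong₂ ℤ._+_ (e 0) (sumUpTo-minus (f ∘ suc) (g ∘ suc) (h ∘ suc) N (e ∘ suc)))
        (rearrange (g 0) (h 0) (sumUpTo (g ∘ suc) N) (sumUpTo (h ∘ suc) N))
  where
  rearrange : ∀ a b c d → (a ℤ.- b) ℤ.+ (c ℤ.- d) ≡ (a ℤ.+ c) ℤ.- (b ℤ.+ d)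
  rearrange = ℤ-Solver.solve-∀

coeff : ℕ → ℕ → ℕ → ℕ
coeff m K j = ((m ∸ j) !) * ((K ∸ j) C j)

signed : ℕ → ℕ → ℕ → ℤ
signed m K j = (-1ℤ ℤ.^ j) ℤ.* (+ coeff m K j)

0C[1+j]≡0 : ∀ j → 0 C suc j ≡ 0
0C[1+j]≡0 j = k>n⇒nCk≡0 {n = 0} {k = suc j} (s≤s z≤n)

nC0≡1 : ∀ n → n C 0 ≡ 1
nC0≡1 n = trans (nCk≡nC[n∸k] {k = 0} {n = n} z≤n) (nCn≡1 n)

-- For `j` above `K` all truncated differences are 0 while the lower indices are positive, so every
-- binomial vanishes.
pascal-∸ : ∀ K j → (suc K ∸ j) C suc j ≡ (K ∸ j) C suc j + (K ∸ j) C j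
pascal-∸ K j with ≤-<-connex j K
... | inj₁ j≤K = begin
  (suc K ∸ j) C suc j               ≡⟨ cong (_C suc j) (+-∸-assoc 1 j≤K) ⟩
  suc (K ∸ j) C suc j               ≡⟨ nCk+nC[k+1]≡[n+1]C[k+1] (K ∸ j) j ⟨
  (K ∸ j) C j + (K ∸ j) C suc j     ≡⟨ +-comm ((K ∸ j) C j) _ ⟩
  (K ∸ j) C suc j + (K ∸ j) C j     ∎
  where open ≡-Reasoning
pascal-∸ K (suc j) | inj₂ (s≤s K≤j)
  rewrite m≤n⇒m∸n≡0 K≤j | m≤n⇒m∸n≡0 {K} {suc j} (≤-trans K≤j (n≤1+n j))
  = trans (0C[1+j]≡0 (suc j)) (sym (cong₂ _+_ (0C[1+j]≡0 (suc j)) (0C[1+j]≡0 j)))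

-- Pascal's rule splits the binomial. The factorial is shared because (m+1)-(j+1) = m-j, and the
-- extra factor -1 turns the second part into a subtraction.
signed-suc : ∀ m K j → signed (suc m) (suc (suc K)) (suc j) ≡ signed (suc m) (suc K) (suc j) ℤ.- signed m K j
signed-suc m K j = begin
  (-1ℤ ℤ.* s) ℤ.* (+ (f * ((suc K ∸ j) C suc j)))
    ≡⟨ cong (λ z → (-1ℤ ℤ.* s) ℤ.* (+ z)) (trans (cong (f *_) (pascal-∸ K j)) (*-distribˡ-+ f _ _)) ⟩
  (-1ℤ ℤ.* s) ℤ.* (+ (f * ((K ∸ j) C suc j)) ℤ.+ + (f * ((K ∸ j) C j)))
    ≡⟨ rearrange s (+ (f * ((K ∸ j) C suc j))) (+ (f * ((K ∸ j) C j))) ⟩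
  (-1ℤ ℤ.* s) ℤ.* (+ (f * ((K ∸ j) C suc j))) ℤ.- s ℤ.* (+ (f * ((K ∸ j) C j))) ∎
  where
  open ≡-Reasoning
  s = -1ℤ ℤ.^ j
  f = (m ∸ j) !
  rearrange : ∀ s a b → (-1ℤ ℤ.* s) ℤ.* (a ℤ.+ b) ≡ (-1ℤ ℤ.* s) ℤ.* a ℤ.- s ℤ.* b
  rearrange = ℤ-Solver.solve-∀

signed-zero : ∀ m K → signed m K 0 ≡ + (m !)
signed-zero m K = trans (ℤₚ.*-identityˡ _) (cong +_ (trans (cong (m ! *_) (nC0≡1 K)) (*-identityʳ _)))

sumUpTo-signed-suc : ∀ m K N → sumUpTo (signed (suc m) (suc (suc K))) (suc N) ≡
                     sumUpTo (signed (suc m) (suc K)) (suc N) ℤ.- sumUpTo (signed m K) N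
sumUpTo-signed-suc m K N =
  trans (cong₂ ℤ._+_ (trans (signed-zero (suc m) (suc (suc K))) (sym (signed-zero (suc m) (suc K))))
          (sumUpTo-minus _ _ (signed m K) N (signed-suc m K)))
        (sym (ℤₚ.+-assoc (signed (suc m) (suc K) 0) _ _))

sumUpTo-signed-small : ∀ m K N → (∀ j → K ∸ suc j ≡ 0) → sumUpTo (signed m K) (suc N) ≡ + (m !)
sumUpTo-signed-small m K N K≤1 = trans (cong₂ ℤ._+_ (signed-zero m K) (sumUpTo-zero _ N vanish)) (ℤₚ.+-identityʳ _)
  where
  vanish : ∀ j → signed m K (suc j) ≡ 0ℤ
  vanish j = trans (cong (λ z → (-1ℤ ℤ.^ suc j) ℤ.* (+ z))
                     (trans (cong (λ d → ((m ∸ suc j) !) * (d C suc j)) (K≤1 j))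
                            (trans (cong (((m ∸ suc j) !) *_) (0C[1+j]≡0 j)) (*-zeroʳ ((m ∸ suc j) !)))))
                   (ℤₚ.*-zeroʳ (-1ℤ ℤ.^ suc j))

-- Listed downwards so that the two largest of 1, ..., K stand first, ready for `countNormal-step`.
-- `E` collects letters above K, which are not yet or no longer restricted.
alphabet : ℕ → List ℕ → List ℕ
alphabet K E = map suc (downFrom K) ++ E

alphabet-avoids : ∀ K {E} → All (suc (suc K) <_) E → All (λ y → y ≢ 0 × y ≢ suc K × y ≢ suc (suc K)) (alphabet K E)
alphabet-avoids K {E} hE = Allₚ.++⁺ (Allₚ.map⁺ (All.tabulate small)) (All.map large hE)
  where
  small : ∀ {i} → i ∈ downFrom K → suc i ≢ 0 × suc i ≢ suc K × suc i ≢ suc (suc K)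
  small m = (λ ()) , <⇒≢ (s≤s i<K) , <⇒≢ (s≤s (<-trans i<K (n<1+n K)))
    where i<K = ∈-downFrom⁻ m
  large : ∀ {y} → suc (suc K) < y → y ≢ 0 × y ≢ suc K × y ≢ suc (suc K)
  large lt = (λ { refl → n≮0 lt }) , (<⇒≢ (<-trans (n<1+n _) lt) ∘ sym) , (<⇒≢ lt ∘ sym)

-- C(K-j, j) vanishes for 2j > K, so under K ≤ 2N+1 the first N+1 terms are the whole sum. From K+2
-- and N+1 the bound passes to K+1 with N+1 and to K with N, matching the shift of index in Pascal's
-- rule.
countNormal-formula : ∀ K E N → All (K <_) E → K ≤ suc (N * 2) →
  + countNormal K (alphabet K E) ≡ sumUpTo (signed (K + length E) K) (suc N)
countNormal-formula zero E N hE K≤ =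
  trans (cong +_ (trans (sumPerms-const 1 E) (*-identityʳ _)))
        (sym (sumUpTo-signed-small (length E) 0 N λ _ → refl))
countNormal-formula (suc zero) E N hE K≤ =
  trans (cong +_ (trans (sumPerms-const 1 (1 ∷ E)) (*-identityʳ _)))
        (sym (sumUpTo-signed-small (suc (length E)) 1 N λ { zero → refl ; (suc _) → refl }))
countNormal-formula (suc (suc K)) E zero hE (s≤s ())
countNormal-formula (suc (suc K)) E (suc N) hE (s≤s (s≤s K≤)) = begin
  + countNormal (suc (suc K)) (c ∷ b ∷ A)
    ≡⟨ minus (countNormal (suc (suc K)) (c ∷ b ∷ A)) (countNormal K (b ∷ A)) ⟩
  + (countNormal (suc (suc K)) (c ∷ b ∷ A) + countNormal K (b ∷ A)) ℤ.- + countNormal K (b ∷ A)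
    -- In the first term `c` survives and joins the letters of `E`; in the second `c` is deleted and
    -- `b` joins them.
    ≡⟨ cong₂ (λ x y → + x ℤ.- + y)
         (trans (sym (countNormal-step (alphabet-avoids K hE)))
                (sumPerms-↭ _ (↭-sym (shift c (map suc (downFrom (suc K))) E))))
         (sumPerms-↭ _ (↭-sym (shift b (map suc (downFrom K)) E))) ⟩
  + countNormal (suc K) (alphabet (suc K) (c ∷ E)) ℤ.- + countNormal K (alphabet K (b ∷ E))
    ≡⟨ cong₂ ℤ._-_
         (countNormal-formula (suc K) (c ∷ E) (suc N) (n<1+n _ ∷ All.map (<-trans (n<1+n _)) hE) (s≤s (≤-trans K≤ (n≤1+n _))))
         (countNormal-formula K (b ∷ E) N (n<1+n _ ∷ All.map (λ lt → <-trans (n<1+n _) (<-trans (n<1+n _) lt)) hE) K≤) ⟩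
  sumUpTo (signed (suc (K + suc (length E))) (suc K)) (suc (suc N)) ℤ.- sumUpTo (signed (K + suc (length E)) K) (suc N)
    ≡⟨ sumUpTo-signed-suc (K + suc (length E)) K (suc N) ⟨
  sumUpTo (signed (suc (K + suc (length E))) (suc (suc K))) (suc (suc N))
    ≡⟨ cong (λ m → sumUpTo (signed (suc m) (suc (suc K))) (suc (suc N))) (+-suc K (length E)) ⟩
  sumUpTo (signed (suc (suc K) + length E) (suc (suc K))) (suc (suc N)) ∎
  where
  open ≡-Reasoning
  A = alphabet K E
  b = suc K
  c = suc (suc K)
  minus : ∀ x y → + x ≡ + (x + y) ℤ.- + y
  minus x y = minusℤ (+ x) (+ y)
    where
    minusℤ : ∀ x y → x ≡ (x ℤ.+ y) ℤ.- y
    minusℤ = ℤ-Solver.solve-∀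

n≤1+[n/2]*2 : ∀ n → n ≤ suc ((n / 2) * 2)
n≤1+[n/2]*2 n = ≤-trans (≤-reflexive (m≡m%n+[m/n]*n n 2)) (+-monoˡ-≤ ((n / 2) * 2) (≤-pred (m%n<n n 2)))

formula-sumUpTo : ∀ n → formula n ≡ sumUpTo (signed n n) (suc (n / 2))
formula-sumUpTo n = trans (cong (foldr ℤ._+_ 0ℤ) (map-upTo (term n) (suc (n / 2)))) (foldr-applyUpTo (term n) (suc (n / 2)))

countNormal-alphabet : ∀ n → + countNormal n (alphabet n []) ≡ formula n
countNormal-alphabet n = begin
  + countNormal n (alphabet n [])               ≡⟨ countNormal-formula n [] (n / 2) [] (n≤1+[n/2]*2 n) ⟩
  sumUpTo (signed (n + 0) n) (suc (n / 2))      ≡⟨ cong (λ m → sumUpTo (signed m n) (suc (n / 2))) (+-identityʳ n) ⟩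
  sumUpTo (signed n n) (suc (n / 2))            ≡⟨ formula-sumUpTo n ⟨
  formula n                                     ∎
  where open ≡-Reasoning

-- Representatives

alphabet-↭ : ∀ n → alphabet n [] ↭ map suc (upTo n)
alphabet-↭ n = ↭-trans (↭-reflexive (++-identityʳ (map suc (downFrom n))))
  (map⁺ suc (↭-trans (↭-reflexive (sym (reverse-upTo n))) (↭-reverse (upTo n))))

IsPerm⇒Unique : ∀ {n w} → IsPerm n w → Unique w
IsPerm⇒Unique {n} p = Unique-resp-↭ (↭-sym p) (Uniqueₚ.map⁺ suc-injective (Uniqueₚ.upTo⁺ n))

IsPerm-∈ : ∀ {n w x} → IsPerm n w → x ∈ w → 0 < x × x ≤ n
IsPerm-∈ p x∈ with _ , m , refl ← ∈-map⁻ suc (∈-resp-↭ p x∈) = s≤s z≤n , ∈-upTo⁻ m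

-- A factor with top 0 or 1 would need the letter 0, and a top above `n` would be a letter above
-- `n`.
NormalUpTo⇒Normal : ∀ {n w} → IsPerm n w → NormalUpTo n w → Normal w
NormalUpTo⇒Normal p N {zero}        f with () ← proj₁ (IsPerm-∈ p (Factor⇒top∈ f))
NormalUpTo⇒Normal p N {suc zero}    f with () ← proj₁ (IsPerm-∈ p (Factor⇒pred∈ f))
NormalUpTo⇒Normal p N {suc (suc k)} f = N (proj₂ (IsPerm-∈ p (Factor⇒top∈ f))) f

normalPerms : ℕ → List (List ℕ)
normalPerms n = filter (normalUpTo? n) (perms (alphabet n []))

∈-normalPerms⁻ : ∀ {n w} → w ∈ normalPerms n → IsPerm n w × Normal w
∈-normalPerms⁻ {n} m with m′ , N ← ∈-filter⁻ (normalUpTo? n) {xs = perms (alphabet n [])} m =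
  p , NormalUpTo⇒Normal p N
  where p = ↭-trans (∈-perms⇒↭ (alphabet n []) m′) (alphabet-↭ n)

normalPerms-ClassReps : ∀ n → ClassReps n (normalPerms n)
normalPerms-ClassReps n = record
  { reps-perm     = All.map proj₁ normal
  ; reps-distinct = AllPairs-map-All
      (λ (pu , Nu) (_ , Nv) u≢v u∼v → u≢v (Normal-∼⇒≡ (IsPerm⇒Unique pu) Nu Nv u∼v))
      normal (Uniqueₚ.filter⁺ (normalUpTo? n) (perms-Unique (IsPerm⇒Unique (alphabet-↭ n))))
  -- The representative of `w` is its normal form.
  ; reps-cover    = λ w p → lose
      (∈-filter⁺ (normalUpTo? n)
        (↭⇒∈-perms (alphabet n []) (↭-trans (normalise-↭ w) (↭-trans p (↭-sym (alphabet-↭ n)))))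
        (λ _ → normalise-Normal (IsPerm⇒Unique p)))
      (normalise-∼ w)
  }
  where
  normal : All (λ w → IsPerm n w × Normal w) (normalPerms n)
  normal = All.tabulate ∈-normalPerms⁻

length-normalPerms : ∀ n → length (normalPerms n) ≡ countNormal n (alphabet n [])
length-normalPerms n = trans (length-filter-sum (normalUpTo? n) (perms (alphabet n [])))
                             (sum-perms (indicator ∘ normalUpTo? n) (alphabet n []))

theorem2p2 : (n : ℕ) → Σ (List (List ℕ)) (λ reps → ClassReps n reps × (+ length reps) ≡ formula n)
theorem2p2 n = normalPerms n , normalPerms-ClassReps n ,
  trans (cong +_ (length-normalPerms n)) (countNormal-alphabet n)
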